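{- For all $n\ge 0$, the quadruples of statistics $(\operatorname{asc},\operatorname{des},\operatorname{MNA},\operatorname{MND})$ and $(\operatorname{des},\operatorname{asc},\operatorname{MND},\operatorname{MNA})$ are equidistributed on $S_n(231,312)$, i.e. $$\sum_{\pi\in S_n(231,312)} t_1^{\operatorname{asc}(\pi)}t_2^{\operatorname{des}(\pi)}t_3^{\operatorname{MNA}(\pi)}t_4^{\operatorname{MND}(\pi)}=\sum_{\pi\in S_n(231,312)} t_1^{\operatorname{des}(\pi)}t_2^{\operatorname{asc}(\pi)}t_3^{\operatorname{MND}(\pi)}t_4^{\operatorname{MNA}(\pi)}.$$
   Context: For $n\ge 0$, $S_n$ denotes the set of permutations $\pi=\pi_1\cdots\pi_n$ of $[n]=\{1,\dots,n\}$. $\pi$ avoids a pattern $\tau\in S_k$ if no subsequence $\pi_{i_1}\cdots\pi_{i_k}$ ($i_1<\dots<i_k$) satisfies $\pi_{i_a}<\pi_{i_b}\iff\tau_a<\tau_b$; $S_n(\tau,\rho)$ is the set of permutations in $S_n$ avoiding both $\tau$ and $\rho$. $\operatorname{asc}(\pi)$ (resp. $\operatorname{des}(\pi)$) is the number of $i\in[n-1]$ with $\pi_i<\pi_{i+1}$ (resp. $\pi_i>\pi_{i+1}$). $\operatorname{MNA}(\pi)$ is the maximum size of a set $I\subseteq[n-1]$ such that $\pi_i<\pi_{i+1}$ for all $i\in I$ and $|i-j|\ge 2$ for distinct $i,j\in I$; $\operatorname{MND}(\pi)$ is defined analogously with $\pi_i>\pi_{i+1}$. -}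

module Defs where

open import Algebra.Bundles using (CommutativeSemiring)
open import Data.Fin.Base using (Fin; suc; toℕ; inject₁; _<_)
open import Data.Fin.Patterns using (0F; 1F; 2F)
open import Data.Fin.Properties using (_≟_; _<?_; all?)
open import Data.Fin.Subset using (Subset; inside; outside; _∈_; ∣_∣)
open import Data.Fin.Subset.Properties using (_∈?_; _⊆?_)
open import Data.List.Base using (List; []; _∷_; map; filter; foldr; length; allFin; cartesianProductWith)
open import Data.List.Extrema.Nat using (max)
import Data.List.Membership.Propositional as List
open import Data.List.Membership.Propositional.Properties using (∈-cartesianProductWith⁺; ∈-allFin)
open import Data.List.Relation.Unary.All using ([])
open import Data.List.Relation.Unary.AllPairs using ([]; _∷_)
open import Data.List.Relation.Unary.Any as Any using (here)
import Data.List.Relation.Unary.Unique.Propositional as List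
open import Data.List.Relation.Unary.Unique.Propositional.Properties using (cartesianProductWith⁺)
open import Data.Nat.Base as ℕ using (ℕ; zero; suc; pred)
import Data.Nat.Properties as ℕ
open import Data.Product.Base using (∃-syntax; _×_; _,_)
open import Data.Product.Properties using (≡-dec)
open import Data.Vec.Base using (Vec; []; _∷_; lookup; tabulate)
open import Data.Vec.Properties using (∷-injective)
open import Data.Vec.Relation.Unary.AllPairs using (allPairs?)
open import Data.Vec.Relation.Unary.Unique.Propositional using (Unique)
open import Function.Bundles using (_⇔_; mk⇔; Equivalence)
open import Level using (Level)
open import Relation.Binary.Definitions using (DecidableEquality)
open import Relation.Binary.PropositionalEquality using (_≡_; _≢_; refl)
open import Relation.Nullary.Decidable using (Dec; does; map′; ¬?; _×-dec_; _→-dec_)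
open import Relation.Nullary.Negation using (¬_)

private
  variable
    a b : Level
    A : Set a
    B : Set b
    k m n : ℕ

words : List A → ∀ k → List (Vec A k)
words xs zero    = [] ∷ []
words xs (suc k) = cartesianProductWith _∷_ xs (words xs k)

-- `words xs k` lists every word with letters in `xs`, and lists it once if
-- `xs` has no repetition.

∈-words : ∀ {xs : List A} → (∀ x → x List.∈ xs) → (w : Vec A k) → w List.∈ words xs k
∈-words all []      = here refl
∈-words all (x ∷ w) = ∈-cartesianProductWith⁺ _∷_ (all x) (∈-words all w)

words-unique : ∀ {xs : List A} → List.Unique xs → ∀ k → List.Unique (words xs k)
words-unique xs! zero    = [] ∷ []
words-unique xs! (suc k) = cartesianProductWith⁺ _∷_ ∷-injective xs! (words-unique xs! k)

-- Words are 0-based: the letter (or position) i of the paper is i - 1 here.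

StrictlyIncreasing : Vec (Fin n) k → Set
StrictlyIncreasing {k = k} is = ∀ (a b : Fin k) → a < b → lookup is a < lookup is b

OccursAt : Vec (Fin k) k → Vec (Fin n) m → Vec (Fin m) k → Set
OccursAt {k = k} τ π is = ∀ (a b : Fin k) →
  (lookup π (lookup is a) < lookup π (lookup is b)) ⇔ (lookup τ a < lookup τ b)

Contains : Vec (Fin n) m → Vec (Fin k) k → Set
Contains {m = m} {k = k} π τ =
  ∃[ is ] StrictlyIncreasing {n = m} {k = k} is × OccursAt τ π is

Avoids : Vec (Fin n) m → Vec (Fin k) k → Set
Avoids π τ = ¬ Contains π τ

_⇔-dec_ : ∀ {P : Set a} {Q : Set b} → Dec P → Dec Q → Dec (P ⇔ Q)
P? ⇔-dec Q? = map′ (λ (f , g) → mk⇔ f g) (λ e → Equivalence.to e , Equivalence.from e)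
  ((P? →-dec Q?) ×-dec (Q? →-dec P?))

contains? : (π : Vec (Fin n) m) (τ : Vec (Fin k) k) → Dec (Contains π τ)
contains? {m = m} {k = k} π τ =
  map′ Any.satisfied (λ (is , occ) → List.lose (∈-words ∈-allFin is) occ)
    (Any.any? occurrence? (words (allFin m) k))
  where
  occurrence? : ∀ is → Dec (StrictlyIncreasing is × OccursAt τ π is)
  occurrence? is =
    all? (λ a → all? λ b → (a <? b) →-dec (lookup is a <? lookup is b))
    ×-dec
    all? (λ a → all? λ b →
      (lookup π (lookup is a) <? lookup π (lookup is b)) ⇔-dec (lookup τ a <? lookup τ b))

avoids? : (π : Vec (Fin n) m) (τ : Vec (Fin k) k) → Dec (Avoids π τ)
avoids? π τ = ¬? (contains? π τ)

unique? : (π : Vec (Fin n) m) → Dec (Unique π)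
unique? = allPairs? (λ i j → ¬? (i ≟ j))

-- A word of length n over Fin n is a permutation iff its letters are distinct.
S : ∀ n → Vec (Fin k) k → Vec (Fin m) m → List (Vec (Fin n) n)
S n τ ρ = filter (λ π → unique? π ×-dec (avoids? π τ ×-dec avoids? π ρ)) (words (allFin n) n)

231′ 312′ : Vec (Fin 3) 3
231′ = 1F ∷ 2F ∷ 0F ∷ []
312′ = 2F ∷ 0F ∷ 1F ∷ []

ascents : Vec (Fin n) m → Subset (pred m)
ascents {m = zero}  π = []
ascents {m = suc _} π = tabulate λ i → does (lookup π (inject₁ i) <? lookup π (suc i))

descents : Vec (Fin n) m → Subset (pred m)
descents {m = zero}  π = []
descents {m = suc _} π = tabulate λ i → does (lookup π (suc i) <? lookup π (inject₁ i))

NonOverlapping : Subset m → Set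
NonOverlapping {m} I =
  ∀ (i : Fin m) → i ∈ I → ∀ (j : Fin m) → j ∈ I → i ≢ j → 2 ℕ.≤ ℕ.∣ toℕ i - toℕ j ∣

nonOverlapping? : (I : Subset m) → Dec (NonOverlapping I)
nonOverlapping? I = all? λ i → (i ∈? I) →-dec all? λ j → (j ∈? I) →-dec
  (¬? (i ≟ j) →-dec (2 ℕ.≤? ℕ.∣ toℕ i - toℕ j ∣))

-- The default value 0 is the size of the empty set, which always qualifies.
maxNonOverlapping : Subset m → ℕ
maxNonOverlapping {m} D =
  max 0 (map ∣_∣ (filter (λ I → (I ⊆? D) ×-dec nonOverlapping? I)
                         (words (inside ∷ outside ∷ []) m)))

asc des MNA MND : Vec (Fin n) n → ℕ
asc π = ∣ ascents π ∣
des π = ∣ descents π ∣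
MNA π = maxNonOverlapping (ascents π)
MND π = maxNonOverlapping (descents π)

count : DecidableEquality B → (A → B) → B → List A → ℕ
count _≟ᴮ_ f b xs = length (filter (λ x → f x ≟ᴮ b) xs)

Quadruple : Set
Quadruple = ℕ × ℕ × ℕ × ℕ

_≟⁴_ : DecidableEquality Quadruple
_≟⁴_ = ≡-dec ℕ._≟_ (≡-dec ℕ._≟_ (≡-dec ℕ._≟_ ℕ._≟_))

EquidistributedOn : List A → (f g : A → Quadruple) → Set
EquidistributedOn xs f g = ∀ q → count _≟⁴_ f q xs ≡ count _≟⁴_ g q xs

module GeneratingFunction {c ℓ} (R : CommutativeSemiring c ℓ) where
  open CommutativeSemiring R public using (Carrier; _≈_; _*_)
  open CommutativeSemiring R using (_+_; 0#; semiring)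
  open import Algebra.Properties.Semiring.Exp semiring public using (_^_)

  ∑ : List A → (A → Carrier) → Carrier
  ∑ xs f = foldr _+_ 0# (map f xs)

  infix 5 ∑
  syntax ∑ xs (λ x → e) = ∑[ x ∈ xs ] e

{-# OPTIONS --safe #-}

-- A permutation avoiding 231 and 312 is layered, hence determined by its
-- descent set, which may be any subset of [n-1]; its ascent set is the
-- complement.  All four statistics depend on these two sets only, so
-- complementing the descent set exchanges them as required.
--
-- The bijection with subsets is built letter by letter: the first letter p of a
-- layered permutation is determined by the standardisation σ of the remaining
-- ones, being the least letter if p starts an ascent and one more than the
-- first letter of σ if p starts a descent.
module Submission where

open import Algebra.Bundles using (CommutativeSemiring)
open import Data.Bool.Base using (Bool; true; false; not)
open import Data.Bool.Properties using (not-involutive)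
open import Data.Fin.Base using (Fin; zero; suc; toℕ; fromℕ<; inject₁; punchIn; punchOut; _<_)
open import Data.Fin.Patterns using (0F; 1F; 2F)
open import Data.Fin.Properties
  using (_≟_; _<?_; any?; ≤∧≢⇒<; toℕ<n; toℕ-fromℕ<;
         injective⇒≤; punchInᵢ≢i; punchIn-injective; punchIn-mono-≤; punchIn-cancel-≤;
         punchIn-punchOut; punchOut-injective)
open import Data.Fin.Subset using (Subset; inside; outside; ∁; ∣_∣)
open import Data.List.Base as List using (List; []; _∷_; filter; length; allFin)
open import Data.List.Membership.Propositional using (_∈_)
open import Data.List.Membership.Propositional.Properties
  using (∈-allFin; ∈-filter⁺; ∈-filter⁻; ∈-map⁺; ∈-map⁻)
open import Data.List.Membership.Propositional.Properties.WithK using (unique∧set⇒bag)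
import Data.List.Properties as List
open import Data.List.Relation.Binary.BagAndSetEquality using (∼bag⇒↭)
open import Data.List.Relation.Binary.Permutation.Propositional
  using (_↭_; ↭-refl; ↭-trans; ↭-reflexive; ↭⇒↭ₛ′; module PermutationReasoning)
import Data.List.Relation.Binary.Permutation.Propositional.Properties as ↭
open import Data.List.Relation.Unary.All using ([]; _∷_)
open import Data.List.Relation.Unary.AllPairs using ([]; _∷_)
open import Data.List.Relation.Unary.Any using (here; there)
import Data.List.Relation.Unary.Unique.Propositional as List
import Data.List.Relation.Unary.Unique.Propositional.Properties as List
open import Data.Nat.Base as ℕ using (ℕ; zero; suc; z≤n; s≤s; s≤s⁻¹; z<s; s<s; s<s⁻¹)
import Data.Nat.Properties as ℕ
open import Data.Product.Base using (∃-syntax; _×_; _,_; proj₁; proj₂)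
open import Data.Vec.Base using (Vec; []; _∷_; lookup; map)
open import Data.Vec.Properties using (lookup-map; map-id; map-cong; map-∘; tabulate-cong)
open import Data.Vec.Relation.Unary.All as All using (All; []; _∷_)
import Data.Vec.Relation.Unary.All.Properties as All
open import Data.Vec.Relation.Unary.AllPairs using ([]; _∷_)
open import Data.Vec.Relation.Unary.Unique.Propositional using (Unique)
import Data.Vec.Relation.Unary.Unique.Propositional.Properties as Unique
open import Function.Base using (_∘_)
open import Function.Bundles using (_⇔_; mk⇔; Equivalence)
open import Relation.Binary.PropositionalEquality
  using (_≡_; _≢_; refl; sym; trans; cong; cong₂; subst; subst₂; module ≡-Reasoning)
open import Relation.Nullary.Decidable using (Dec; does; yes; no; does-⇔; dec-true; dec-false; _×-dec_)
open import Relation.Nullary.Negation using (¬_; contradiction)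
open import Defs

private
  variable
    m n : ℕ

-- `punchIn` and the order; the pigeonhole principle.

punchIn-mono-< : ∀ (p : Fin (suc n)) {x y} → x < y → punchIn p x < punchIn p y
punchIn-mono-< p {x} {y} x<y =
  ℕ.≰⇒> λ py≤px → ℕ.<⇒≱ x<y (punchIn-cancel-≤ p y x py≤px)

punchIn-cancel-< : ∀ (p : Fin (suc n)) {x y} → punchIn p x < punchIn p y → x < y
punchIn-cancel-< p {x} {y} px<py =
  ℕ.≰⇒> λ y≤x → ℕ.<⇒≱ px<py (punchIn-mono-≤ p y x y≤x)

punchIn-below : ∀ (p : Fin (suc n)) x → toℕ x ℕ.< toℕ p → punchIn p x < p
punchIn-below (suc p) zero    _   = z<s
punchIn-below (suc p) (suc x) x<p = s<s (punchIn-below p x (s<s⁻¹ x<p))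

punchIn-above : ∀ (p : Fin (suc n)) x → toℕ p ℕ.≤ toℕ x → p < punchIn p x
punchIn-above zero    x       _   = z<s
punchIn-above (suc p) (suc x) p≤x = s<s (punchIn-above p x (s≤s⁻¹ p≤x))

punchIn-below⁻ : ∀ (p : Fin (suc n)) x → punchIn p x < p → toℕ x ℕ.< toℕ p
punchIn-below⁻ p x px<p = ℕ.≰⇒> λ p≤x → ℕ.<-asym (punchIn-above p x p≤x) px<p

punchIn-above⁻ : ∀ (p : Fin (suc n)) x → p < punchIn p x → toℕ p ℕ.≤ toℕ x
punchIn-above⁻ p x p<px = ℕ.≮⇒≥ λ x<p → ℕ.<-asym p<px (punchIn-below p x x<p)

unique-map⁻ : ∀ {A B : Set} {f : A → B} (xs : Vec A n) → Unique (map f xs) → Unique xs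
unique-map⁻ []       []         = []
unique-map⁻ {f = f} (x ∷ xs) (x∉ ∷ xs!) =
  All.map (_∘ cong f) (All.map⁻ x∉) ∷ unique-map⁻ xs xs!

-- Pigeonhole: if `y` were missed, punching it out of every letter would inject `Fin (suc n)` into
-- `Fin n`.
unique⇒surjective : {σ : Vec (Fin n) n} → Unique σ → ∀ y → ∃[ j ] lookup σ j ≡ y
unique⇒surjective {suc n} {σ} σ! y with any? (λ j → lookup σ j ≟ y)
... | yes hit = hit
... | no miss = contradiction (injective⇒≤ squeeze-injective) ℕ.1+n≰n
  where
  y≢ : ∀ j → y ≢ lookup σ j
  y≢ j y≡σj = miss (j , sym y≡σj)

  squeeze : Fin (suc n) → Fin n
  squeeze j = punchOut (y≢ j)

  squeeze-injective : ∀ {i j} → squeeze i ≡ squeeze j → i ≡ j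
  squeeze-injective {i} {j} eq =
    Unique.lookup-injective σ! i j (punchOut-injective (y≢ i) (y≢ j) eq)

-- Pattern occurrences

-- Only the comparisons of letters adjacent in value are stored: the third follows by transitivity,
-- and the reversed ones fail by asymmetry.
Occurs231 Occurs312 : Vec (Fin n) m → Set
Occurs231 π = ∃[ i ] ∃[ j ] ∃[ k ]
  i < j × j < k × lookup π k < lookup π i × lookup π i < lookup π j
Occurs312 π = ∃[ i ] ∃[ j ] ∃[ k ]
  i < j × j < k × lookup π j < lookup π k × lookup π k < lookup π i

strictlyIncreasing₃ : {i j k : Fin m} → i < j → j < k → StrictlyIncreasing (i ∷ j ∷ k ∷ [])
strictlyIncreasing₃ i<j j<k 0F 1F _ = i<j
strictlyIncreasing₃ i<j j<k 0F 2F _ = ℕ.<-trans i<j j<k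
strictlyIncreasing₃ i<j j<k 1F 2F _ = j<k
strictlyIncreasing₃ i<j j<k 1F 1F (s≤s ())
strictlyIncreasing₃ i<j j<k 2F 1F (s≤s ())
strictlyIncreasing₃ i<j j<k 2F 2F (s≤s (s≤s ()))

⇔-true : {P Q : Set} → P → Q → P ⇔ Q
⇔-true p q = mk⇔ (λ _ → q) (λ _ → p)

⇔-false : {P Q : Set} → ¬ P → ¬ Q → P ⇔ Q
⇔-false ¬p ¬q = mk⇔ (λ p → contradiction p ¬p) (λ q → contradiction q ¬q)

contains-231 : (π : Vec (Fin n) m) → Contains π 231′ ⇔ Occurs231 π
contains-231 π = mk⇔ to from
  where
  to : Contains π 231′ → Occurs231 π
  to (i ∷ j ∷ k ∷ [] , incr , occ) =
    i , j , k , incr 0F 1F z<s , incr 1F 2F (s<s z<s) ,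
    Equivalence.from (occ 2F 0F) z<s , Equivalence.from (occ 0F 1F) (s<s z<s)

  from : Occurs231 π → Contains π 231′
  from (i , j , k , i<j , j<k , πk<πi , πi<πj) =
    i ∷ j ∷ k ∷ [] , strictlyIncreasing₃ i<j j<k , occ
    where
    πk<πj = ℕ.<-trans πk<πi πi<πj
    occ : OccursAt 231′ π (i ∷ j ∷ k ∷ [])
    occ 0F 0F = ⇔-false (ℕ.<-irrefl refl) (ℕ.<-irrefl refl)
    occ 0F 1F = ⇔-true πi<πj (s<s z<s)
    occ 0F 2F = ⇔-false (ℕ.<-asym πk<πi) (λ ())
    occ 1F 0F = ⇔-false (ℕ.<-asym πi<πj) (λ { (s≤s ()) })
    occ 1F 1F = ⇔-false (ℕ.<-irrefl refl) (ℕ.<-irrefl refl)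
    occ 1F 2F = ⇔-false (ℕ.<-asym πk<πj) (λ ())
    occ 2F 0F = ⇔-true πk<πi z<s
    occ 2F 1F = ⇔-true πk<πj z<s
    occ 2F 2F = ⇔-false (ℕ.<-irrefl refl) (ℕ.<-irrefl refl)

contains-312 : (π : Vec (Fin n) m) → Contains π 312′ ⇔ Occurs312 π
contains-312 π = mk⇔ to from
  where
  to : Contains π 312′ → Occurs312 π
  to (i ∷ j ∷ k ∷ [] , incr , occ) =
    i , j , k , incr 0F 1F z<s , incr 1F 2F (s<s z<s) ,
    Equivalence.from (occ 1F 2F) z<s , Equivalence.from (occ 2F 0F) (s<s z<s)

  from : Occurs312 π → Contains π 312′
  from (i , j , k , i<j , j<k , πj<πk , πk<πi) =
    i ∷ j ∷ k ∷ [] , strictlyIncreasing₃ i<j j<k , occ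
    where
    πj<πi = ℕ.<-trans πj<πk πk<πi
    occ : OccursAt 312′ π (i ∷ j ∷ k ∷ [])
    occ 0F 0F = ⇔-false (ℕ.<-irrefl refl) (ℕ.<-irrefl refl)
    occ 0F 1F = ⇔-false (ℕ.<-asym πj<πi) (λ ())
    occ 0F 2F = ⇔-false (ℕ.<-asym πk<πi) (λ { (s≤s ()) })
    occ 1F 0F = ⇔-true πj<πi z<s
    occ 1F 1F = ⇔-false (ℕ.<-irrefl refl) (ℕ.<-irrefl refl)
    occ 1F 2F = ⇔-true πj<πk z<s
    occ 2F 0F = ⇔-true πk<πi (s<s z<s)
    occ 2F 1F = ⇔-false (ℕ.<-asym πj<πk) (λ ())
    occ 2F 2F = ⇔-false (ℕ.<-irrefl refl) (ℕ.<-irrefl refl)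

record IsLayered (π : Vec (Fin n) m) : Set where
  constructor mkLayered
  field
    distinct  : Unique π
    avoids231 : ¬ Occurs231 π
    avoids312 : ¬ Occurs312 π

open IsLayered

-- Prepending a letter

prepend : Fin (suc n) → Vec (Fin n) m → Vec (Fin (suc n)) (suc m)
prepend p σ = p ∷ map (punchIn p) σ

module _ (p : Fin (suc n)) (σ : Vec (Fin n) m) where

  lookup-prepend-< : ∀ {i j} → lookup σ i < lookup σ j ⇔
                     lookup (prepend p σ) (suc i) < lookup (prepend p σ) (suc j)
  lookup-prepend-< {i} {j}
    rewrite lookup-map i (punchIn p) σ | lookup-map j (punchIn p) σ =
      mk⇔ (punchIn-mono-< p) (punchIn-cancel-< p)

  -- `punchIn p` fixes the values less than `p` and raises the others by one. A letter of `σ` equal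
  -- to `p` thus ends up above it, which is why the bound is strict here and weak in
  -- `lookup-prepend-above`.
  lookup-prepend-below : ∀ {i} → toℕ (lookup σ i) ℕ.< toℕ p ⇔ lookup (prepend p σ) (suc i) < p
  lookup-prepend-below {i} rewrite lookup-map i (punchIn p) σ =
    mk⇔ (punchIn-below p _) (punchIn-below⁻ p _)

  lookup-prepend-above : ∀ {i} → toℕ p ℕ.≤ toℕ (lookup σ i) ⇔ p < lookup (prepend p σ) (suc i)
  lookup-prepend-above {i} rewrite lookup-map i (punchIn p) σ =
    mk⇔ (punchIn-above p _) (punchIn-above⁻ p _)

  prepend-layered⁻ : IsLayered (prepend p σ) → IsLayered σ
  prepend-layered⁻ (mkLayered (_ ∷ σ!) no231 no312) = mkLayered (unique-map⁻ σ σ!)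
    (λ (i , j , k , i<j , j<k , u , v) → no231 (suc i , suc j , suc k , s<s i<j , s<s j<k ,
       Equivalence.to lookup-prepend-< u , Equivalence.to lookup-prepend-< v))
    (λ (i , j , k , i<j , j<k , u , v) → no312 (suc i , suc j , suc k , s<s i<j , s<s j<k ,
       Equivalence.to lookup-prepend-< u , Equivalence.to lookup-prepend-< v))

  prepend-unique : Unique σ → Unique (prepend p σ)
  prepend-unique σ! =
    All.map⁺ (All.universal (λ x p≡ → punchInᵢ≢i p x (sym p≡)) σ)
    ∷ Unique.map⁺ (λ {x} {y} → punchIn-injective p x y) σ!

-- Shows that a word whose first letter does not recur is of the form `prepend p σ`, so that
-- inductions may match on `refl` and work with `σ`.
standardise : (p : Fin (suc n)) {ρ : Vec (Fin (suc n)) m} → All (p ≢_) ρ →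
              ∃[ σ ] ρ ≡ map (punchIn p) σ
standardise p []         = [] , refl
standardise p (p≢x ∷ p∉) with σ , refl ← standardise p p∉ =
  punchOut p≢x ∷ σ , cong (_∷ _) (sym (punchIn-punchOut p≢x))

-- The first letter of a layered word.

firstLetter : Bool → Fin n → Fin (suc n)
firstLetter inside  s = suc s
firstLetter outside s = zero

-- Supplies the position inequality needed when the head of `σ` is taken as the first entry of a
-- pattern occurrence.
lookup≢head⇒0< : (σ : Vec (Fin n) (suc m)) → ∀ {i} → lookup σ i ≢ lookup σ 0F → 0 ℕ.< toℕ i
lookup≢head⇒0< σ {zero}  σi≢s = contradiction refl σi≢s
lookup≢head⇒0< σ {suc i} _    = z<s

module _ (σ : Vec (Fin n) (suc m)) (σ-layered : IsLayered σ) where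

  private
    <⇒0< : ∀ {i} → lookup σ i < lookup σ 0F → 0 ℕ.< toℕ i
    <⇒0< σi<s = lookup≢head⇒0< σ λ eq → ℕ.<⇒≢ σi<s (cong toℕ eq)

    >⇒0< : ∀ {i} → lookup σ 0F < lookup σ i → 0 ℕ.< toℕ i
    >⇒0< s<σi = lookup≢head⇒0< σ λ eq → ℕ.<⇒≢ s<σi (cong toℕ (sym eq))

    -- Being less than `suc s` allows equality with the head `s`; as `i < j` makes `j` nonzero,
    -- distinctness excludes it.
    head-strict : ∀ {i j : Fin (suc m)} → i < j →
                  toℕ (lookup σ j) ℕ.< suc (toℕ (lookup σ 0F)) → lookup σ j < lookup σ 0F
    head-strict {j = suc j} i<j σj≤s = ≤∧≢⇒< (s≤s⁻¹ σj≤s)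
      λ eq → contradiction (Unique.lookup-injective (distinct σ-layered) (suc j) 0F eq) λ ()

  -- An occurrence inside the tail comes from one in `σ`. The letter `zero` cannot start an
  -- occurrence, since both patterns have a smaller letter after the first. The letter `suc s` lies
  -- just above the head `s` of `σ`, so in an occurrence starting with it `s` can take its place,
  -- giving an occurrence in `σ`.
  firstLetter-layered : ∀ d → IsLayered (prepend (firstLetter d (lookup σ 0F)) σ)
  firstLetter-layered d = mkLayered (prepend-unique p σ (distinct σ-layered)) (no231 d) (no312 d)
    where
    p = firstLetter d (lookup σ 0F)

    no231 : ∀ d → ¬ Occurs231 (prepend (firstLetter d (lookup σ 0F)) σ)
    no231 d (suc i , suc j , suc k , i<j , j<k , u , v) =
      avoids231 σ-layered (i , j , k , s<s⁻¹ i<j , s<s⁻¹ j<k ,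
        Equivalence.from (lookup-prepend-< _ σ) u , Equivalence.from (lookup-prepend-< _ σ) v)
    no231 inside (zero , suc j , suc k , _ , j<k , u , v) =
      avoids231 σ-layered (0F , j , k , >⇒0< s<σj , s<s⁻¹ j<k ,
        head-strict (s<s⁻¹ j<k) (Equivalence.from (lookup-prepend-below _ σ) u) , s<σj)
      where s<σj = Equivalence.from (lookup-prepend-above _ σ) v
    no231 outside (zero , suc j , suc k , _ , _ , () , _)

    no312 : ∀ d → ¬ Occurs312 (prepend (firstLetter d (lookup σ 0F)) σ)
    no312 d (suc i , suc j , suc k , i<j , j<k , u , v) =
      avoids312 σ-layered (i , j , k , s<s⁻¹ i<j , s<s⁻¹ j<k ,
        Equivalence.from (lookup-prepend-< _ σ) u , Equivalence.from (lookup-prepend-< _ σ) v)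
    no312 inside (zero , suc j , suc k , _ , j<k , u , v) =
      avoids312 σ-layered (0F , j , k , <⇒0< (ℕ.<-trans σj<σk σk<s) , s<s⁻¹ j<k , σj<σk , σk<s)
      where
      σj<σk = Equivalence.from (lookup-prepend-< _ σ) u
      σk<s  = head-strict (s<s⁻¹ j<k) (Equivalence.from (lookup-prepend-below _ σ) v)
    no312 outside (zero , suc j , suc k , _ , _ , _ , ())

-- A first letter p other than the two allowed ones leaves a letter strictly
-- between p and the head s of σ (if s < p), or below both (if p ≤ s); it occurs
-- later and completes an occurrence of 312 or 231 respectively.
prepend-layered⇒firstLetter : (p : Fin (2 ℕ.+ n)) (σ : Vec (Fin (suc n)) (suc n)) →
  IsLayered (prepend p σ) → (descent? : Dec (punchIn p (lookup σ 0F) < p)) →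
  p ≡ firstLetter (does descent?) (lookup σ 0F)
prepend-layered⇒firstLetter {n} p σ@(s ∷ _) π-layered (yes ps<p) with p ≟ suc s
... | yes p≡1+s = p≡1+s
... | no  p≢1+s = contradiction
  (0F , 1F , suc j , z<s , s<s 0<j ,
    Equivalence.to (lookup-prepend-< p σ {0F} {j}) s<σj ,
    Equivalence.to (lookup-prepend-below p σ {j}) σj<p)
  (avoids312 π-layered)
  where
  1+s<p : suc (toℕ s) ℕ.< toℕ p
  1+s<p = ≤∧≢⇒< {i = suc s} (punchIn-below⁻ p s ps<p) (p≢1+s ∘ sym)

  -- The intermediate letter is `s + 1`: since `p` is at most `1 + n`, it is still in the alphabet
  -- of `σ`, and `j` is its position.
  1+s<1+n : suc (toℕ s) ℕ.< suc n
  1+s<1+n = ℕ.<-≤-trans 1+s<p (s≤s⁻¹ (toℕ<n p))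

  hit = unique⇒surjective (distinct (prepend-layered⁻ p σ π-layered)) (fromℕ< 1+s<1+n)
  j   = proj₁ hit

  σj≡1+s : toℕ (lookup σ j) ≡ suc (toℕ s)
  σj≡1+s = trans (cong toℕ (proj₂ hit)) (toℕ-fromℕ< 1+s<1+n)

  s<σj : s < lookup σ j
  s<σj = ℕ.≤-reflexive (sym σj≡1+s)

  σj<p : toℕ (lookup σ j) ℕ.< toℕ p
  σj<p = subst (ℕ._< toℕ p) (sym σj≡1+s) 1+s<p

  0<j : 0 ℕ.< toℕ j
  0<j = lookup≢head⇒0< σ λ eq → ℕ.<⇒≢ s<σj (cong toℕ (sym eq))
prepend-layered⇒firstLetter zero (_ ∷ _) _ (no _) = refl
prepend-layered⇒firstLetter p@(suc _) σ@(s ∷ _) π-layered (no ps≮p) = contradiction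
  (0F , 1F , suc j , z<s , s<s 0<j ,
    Equivalence.to (lookup-prepend-below p σ {j}) (subst (ℕ._< toℕ p) (sym (cong toℕ σj≡0)) z<s) ,
    Equivalence.to (lookup-prepend-above p σ {0F}) p≤s)
  (avoids231 π-layered)
  where
  p≤s : toℕ p ℕ.≤ toℕ s
  p≤s = ℕ.≮⇒≥ (ps≮p ∘ punchIn-below p s)

  hit = unique⇒surjective (distinct (prepend-layered⁻ p σ π-layered)) 0F
  j    = proj₁ hit
  σj≡0 = proj₂ hit

  -- The letter below both is 0. Were it the head of `σ`, then `p ≤ s` would force `p` to be zero,
  -- but `p` is a successor.
  0<j : 0 ℕ.< toℕ j
  0<j = lookup≢head⇒0< σ λ eq →
    ℕ.<⇒≱ (s≤s z≤n) (subst (λ x → toℕ p ℕ.≤ toℕ x) (trans (sym eq) σj≡0) p≤s)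

-- `punchIn p` preserves and reflects `<`, so comparisons within the tail keep their outcome and
-- only the one with `p` is new.
descents-prepend : (p : Fin (suc n)) (σ : Vec (Fin n) (suc m)) →
  descents (prepend p σ) ≡ does (punchIn p (lookup σ 0F) <? p) ∷ descents σ
descents-prepend p σ@(s ∷ _) = cong (does (punchIn p s <? p) ∷_) (tabulate-cong λ i →
  sym (does-⇔ (lookup-prepend-< p σ {suc i} {inject₁ i})
    (lookup σ (suc i) <? lookup σ (inject₁ i)) (_ <? _)))

ascents-prepend : (p : Fin (suc n)) (σ : Vec (Fin n) (suc m)) →
  ascents (prepend p σ) ≡ does (p <? punchIn p (lookup σ 0F)) ∷ ascents σ
ascents-prepend p σ@(s ∷ _) = cong (does (p <? punchIn p s) ∷_) (tabulate-cong λ i →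
  sym (does-⇔ (lookup-prepend-< p σ {inject₁ i} {suc i})
    (lookup σ (inject₁ i) <? lookup σ (suc i)) (_ <? _)))

-- The layered permutation with a given descent set

layered : Subset m → Vec (Fin (suc m)) (suc m)
layered []      = 0F ∷ []
layered (d ∷ D) = prepend (firstLetter d (lookup (layered D) 0F)) (layered D)

layered-isLayered : (D : Subset m) → IsLayered (layered D)
layered-isLayered []      = mkLayered ([] ∷ [])
  (λ { (zero , zero , _ , () , _) }) (λ { (zero , zero , _ , () , _) })
layered-isLayered (d ∷ D) = firstLetter-layered (layered D) (layered-isLayered D) d

-- For `inside`, `punchIn (suc s) s` has the value of `s`, so the word drops by exactly one; for
-- `outside`, the comparison with `zero` computes.
firstLetter-descent : ∀ d (s : Fin n) → does (punchIn (firstLetter d s) s <? firstLetter d s) ≡ d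
firstLetter-descent inside  s = dec-true (_ <? suc s) (punchIn-below (suc s) s (ℕ.n<1+n (toℕ s)))
firstLetter-descent outside s = refl

firstLetter-ascent : ∀ d (s : Fin n) → does (firstLetter d s <? punchIn (firstLetter d s) s) ≡ not d
firstLetter-ascent inside  s = dec-false (suc s <? _) λ s<ps →
  ℕ.1+n≰n (punchIn-above⁻ (suc s) s s<ps)
firstLetter-ascent outside s = refl

descents-layered : (D : Subset m) → descents (layered D) ≡ D
descents-layered []      = refl
descents-layered (d ∷ D) = trans (descents-prepend _ (layered D))
  (cong₂ _∷_ (firstLetter-descent d _) (descents-layered D))

ascents-layered : (D : Subset m) → ascents (layered D) ≡ ∁ D
ascents-layered []      = refl
ascents-layered (d ∷ D) = trans (ascents-prepend _ (layered D))
  (cong₂ _∷_ (firstLetter-ascent d _) (ascents-layered D))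

-- Induction on the length: the tail standardises to a layered `σ`, recovered from its own descents,
-- and `p` is forced to be the letter that `layered` prepends. With `descents-layered` this makes
-- `layered` and `descents` mutually inverse.
layered-descents : (π : Vec (Fin (suc m)) (suc m)) → IsLayered π → layered (descents π) ≡ π
layered-descents {zero}  (zero ∷ []) _ = refl
layered-descents {suc m} (p ∷ ρ) π-layered@(mkLayered (p∉ρ ∷ _) _ _)
  with σ , refl ← standardise p p∉ρ = begin
    layered (descents (prepend p σ))
      ≡⟨ cong layered (descents-prepend p σ) ⟩
    layered (d ∷ descents σ)
      ≡⟨ cong (λ τ → prepend (firstLetter d (lookup τ 0F)) τ)
           (layered-descents σ (prepend-layered⁻ p σ π-layered)) ⟩
    prepend (firstLetter d (lookup σ 0F)) σ
      ≡⟨ cong (λ q → prepend q σ) (prepend-layered⇒firstLetter p σ π-layered (_ <? _)) ⟨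
    prepend p σ ∎
  where
  open ≡-Reasoning
  d = does (punchIn p (lookup σ 0F) <? p)

-- Transport to lists

-- Turns bijections into permutations of lists without tracking the order of enumeration.
unique∧set⇒↭ : ∀ {A : Set} {xs ys : List A} → List.Unique xs → List.Unique ys →
               (∀ {x} → x ∈ xs ⇔ x ∈ ys) → xs ↭ ys
unique∧set⇒↭ xs! ys! xs∼ys = ∼bag⇒↭ (unique∧set⇒bag xs! ys! xs∼ys)

allFin-unique : ∀ n → List.Unique (allFin n)
allFin-unique n = List.tabulate⁺ (λ eq → eq)

subsets : ∀ m → List (Subset m)
subsets = words (inside ∷ outside ∷ [])

∈-subsets : (D : Subset m) → D ∈ subsets m
∈-subsets = ∈-words λ { inside → here refl ; outside → there (here refl) }

subsets-unique : ∀ m → List.Unique (subsets m)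
subsets-unique = words-unique (((λ ()) ∷ []) ∷ [] ∷ [])

∁-involutive : (D : Subset m) → ∁ (∁ D) ≡ D
∁-involutive D = trans (sym (map-∘ not not D)) (trans (map-cong not-involutive D) (map-id D))

-- An involution is injective and hits every subset, so it merely reorders the list of all subsets.
∁-subsets : ∀ m → List.map ∁ (subsets m) ↭ subsets m
∁-subsets m = unique∧set⇒↭ (List.map⁺ ∁-injective (subsets-unique m)) (subsets-unique m)
  (λ {D} → mk⇔ (λ _ → ∈-subsets D)
    (λ _ → subst (_∈ List.map ∁ (subsets m)) (∁-involutive D) (∈-map⁺ ∁ (∈-subsets (∁ D)))))
  where
  ∁-injective : {D E : Subset m} → ∁ D ≡ ∁ E → D ≡ E
  ∁-injective {D} {E} eq = trans (sym (∁-involutive D)) (trans (cong ∁ eq) (∁-involutive E))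

-- `layered-descents` puts each avoiding permutation in the image of `layered`, and
-- `layered-isLayered` gives the converse. The image has no repetition because `descents` is a left
-- inverse.
S-layered : ∀ m → S (suc m) 231′ 312′ ↭ List.map layered (subsets m)
S-layered m = unique∧set⇒↭
  (List.filter⁺ S? (words-unique (allFin-unique _) _))
  (List.map⁺ layered-injective (subsets-unique m))
  (mk⇔ to from)
  where
  S? = λ (π : Vec (Fin (suc m)) (suc m)) →
    unique? π ×-dec (avoids? π 231′ ×-dec avoids? π 312′)

  layered-injective : {D E : Subset m} → layered D ≡ layered E → D ≡ E
  layered-injective {D} {E} eq =
    trans (sym (descents-layered D)) (trans (cong descents eq) (descents-layered E))

  to : ∀ {π} → π ∈ S (suc m) 231′ 312′ → π ∈ List.map layered (subsets m)
  to {π} π∈S with _ , π! , no231 , no312 ← ∈-filter⁻ S? {xs = words (allFin _) _} π∈S =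
    subst (_∈ List.map layered (subsets m))
      (layered-descents π (mkLayered π!
        (no231 ∘ Equivalence.from (contains-231 π)) (no312 ∘ Equivalence.from (contains-312 π))))
      (∈-map⁺ layered (∈-subsets (descents π)))

  from : ∀ {π} → π ∈ List.map layered (subsets m) → π ∈ S (suc m) 231′ 312′
  from π∈ with D , _ , refl ← ∈-map⁻ layered π∈ =
    ∈-filter⁺ S? (∈-words ∈-allFin (layered D))
      (distinct L , avoids231 L ∘ Equivalence.to (contains-231 (layered D)) ,
        avoids312 L ∘ Equivalence.to (contains-312 (layered D)))
    where
    L = layered-isLayered D

-- The statistics as functions of the ascent and descent sets.

statistics : Subset m → Subset m → Quadruple
statistics A D = ∣ A ∣ , ∣ D ∣ , maxNonOverlapping A , maxNonOverlapping D

-- Exchanging the arguments of `statistics` exchanges both pairs of statistics at once. Permuting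
-- the lists of values is strong enough to yield both the counting form and the generating function
-- form.
statistics-↭ : ∀ n →
  List.map (λ π → statistics (ascents π) (descents π)) (S n 231′ 312′) ↭
  List.map (λ π → statistics (descents π) (ascents π)) (S n 231′ 312′)
-- `layered` yields nonempty words only, so length 0 is separate; there both sets are `[]` by
-- definition.
statistics-↭ zero    = ↭-refl
statistics-↭ (suc m) = begin
  List.map F (S (suc m) 231′ 312′)                            ↭⟨ along-layered F F∘layered ⟩
  -- The exchange happens here: reindexing by `∁` replaces `D` by `∁ D`, and the resulting double
  -- complement cancels.
  List.map (λ D → statistics (∁ D) D) (subsets m)             ↭⟨ ↭.map⁺ _ (∁-subsets m) ⟨
  List.map (λ D → statistics (∁ D) D) (List.map ∁ (subsets m))
    ≡⟨ List.map-∘ (subsets m) ⟨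
  List.map (λ D → statistics (∁ (∁ D)) (∁ D)) (subsets m)
    ≡⟨ List.map-cong (λ D → cong (λ E → statistics E (∁ D)) (∁-involutive D)) (subsets m) ⟩
  List.map (λ D → statistics D (∁ D)) (subsets m)             ↭⟨ along-layered G G∘layered ⟨
  List.map G (S (suc m) 231′ 312′)                            ∎
  where
  open PermutationReasoning

  F = λ (π : Vec (Fin (suc m)) (suc m)) → statistics (ascents π) (descents π)
  G = λ (π : Vec (Fin (suc m)) (suc m)) → statistics (descents π) (ascents π)

  F∘layered : ∀ D → F (layered D) ≡ statistics (∁ D) D
  F∘layered D = cong₂ statistics (ascents-layered D) (descents-layered D)

  G∘layered : ∀ D → G (layered D) ≡ statistics D (∁ D)
  G∘layered D = cong₂ statistics (descents-layered D) (ascents-layered D)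

  along-layered : (H : Vec (Fin (suc m)) (suc m) → Quadruple) {h : Subset m → Quadruple} →
    (∀ D → H (layered D) ≡ h D) →
    List.map H (S (suc m) 231′ 312′) ↭ List.map h (subsets m)
  along-layered H H∘layered = ↭-trans (↭.map⁺ H (S-layered m))
    (↭-reflexive (trans (sym (List.map-∘ (subsets m))) (List.map-cong H∘layered (subsets m))))

count-map : ∀ {A : Set} (f : A → Quadruple) q xs →
  count _≟⁴_ f q xs ≡ length (filter (_≟⁴ q) (List.map f xs))
count-map f q []       = refl
count-map f q (x ∷ xs) with does (f x ≟⁴ q)
... | true  = cong suc (count-map f q xs)
... | false = count-map f q xs

equidistributed : ∀ {A : Set} {f g : A → Quadruple} {xs} →
  List.map f xs ↭ List.map g xs → EquidistributedOn xs f g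
equidistributed {f = f} {g} {xs} fxs↭gxs q = begin
  count _≟⁴_ f q xs                          ≡⟨ count-map f q xs ⟩
  length (filter (_≟⁴ q) (List.map f xs))    ≡⟨ ↭.↭-length (↭.filter-↭ (_≟⁴ q) fxs↭gxs) ⟩
  length (filter (_≟⁴ q) (List.map g xs))    ≡⟨ count-map g q xs ⟨
  count _≟⁴_ g q xs                          ∎
  where open ≡-Reasoning

module _ {c ℓ} (R : CommutativeSemiring c ℓ) where
  open CommutativeSemiring R using (setoid; isEquivalence; +-isCommutativeMonoid)
  open GeneratingFunction R
  open import Data.List.Relation.Binary.Permutation.Setoid.Properties setoid using (foldr-commMonoid)

  -- A fold in a commutative monoid ignores order. The semiring has its own equality `≈`, so the
  -- permutation is first converted to one over its setoid.
  ∑-↭ : ∀ {A : Set} {f g : A → Quadruple} {xs} (h : Quadruple → Carrier) →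
    List.map f xs ↭ List.map g xs → (∑[ x ∈ xs ] h (f x)) ≈ (∑[ x ∈ xs ] h (g x))
  ∑-↭ {xs = xs} h fxs↭gxs = foldr-commMonoid +-isCommutativeMonoid (↭⇒↭ₛ′ isEquivalence
    (subst₂ _↭_ (sym (List.map-∘ xs)) (sym (List.map-∘ xs)) (↭.map⁺ h fxs↭gxs)))

theorem12 : ∀ {c ℓ} (n : ℕ) →
    EquidistributedOn (S n 231′ 312′)
    (λ π → asc π , des π , MNA π , MND π)
    (λ π → des π , asc π , MND π , MNA π)
    ×
    ((R : CommutativeSemiring c ℓ) → let open GeneratingFunction R in
    (t₁ t₂ t₃ t₄ : Carrier) →
    (∑[ π ∈ S n 231′ 312′ ] (t₁ ^ asc π * t₂ ^ des π * t₃ ^ MNA π * t₄ ^ MND π))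
    ≈
    (∑[ π ∈ S n 231′ 312′ ] (t₁ ^ des π * t₂ ^ asc π * t₃ ^ MND π * t₄ ^ MNA π)))
theorem12 n = equidistributed (statistics-↭ n) , λ R t₁ t₂ t₃ t₄ →
  let open GeneratingFunction R in
  -- The weight of a quadruple is the monomial with these exponents; applied to either quadruple of
  -- statistics it unfolds to the corresponding summand.
  ∑-↭ R (λ (a , d , ma , md) → t₁ ^ a * t₂ ^ d * t₃ ^ ma * t₄ ^ md) (statistics-↭ n)
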